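{- Let $\{u_i\}_{i\in\mathbb N}$ be a uniformly computable family of block-density profiles, and let $D\subseteq\mathbb N^2$ be a computable set of ordered pairs. Assume that for each $(i,j)\in D$ we are given, uniformly computably in $(i,j)$, (i) a rational number $\delta_{i,j}>0$; and (ii) a strictly increasing computable function $s_{i,j}:\mathbb N\to\mathbb N$ with infinite range $S_{i,j}=\{s_{i,j}(t):t\in\mathbb N\}$, such that $u_i(k)\ge u_j(k)+\delta_{i,j}$ for every $k\in S_{i,j}$. Then there exist a set $A\subseteq\mathbb N$, computable in $\emptyset'$, and a uniformly computable family of total surjective functions $h_i:\mathbb N\to\mathbb N$ ($i\in\mathbb N$), such that, writing $I_k=[a_k,a_{k+1})$ with $a_0=0$ and $a_{k+1}=a_k+k!$, the following hold: (a) $A$ is constant on each block $I_k$. (b) Each $h_i$ is bounded finite-one with global bound $2$, i.e. $|h_i^{ -1}(y)|\le 2$ for all $y\in\mathbb N$. (c) For $C_i(x)=A(h_i(x))$, one has $C_i\equiv_{\rm bfo}A$ for every $i\in\mathbb N$. (d) If $u_i(k)\le u_j(k)$ for every $k\in\mathbb N$, then $C_i\le_1 C_j$. (e) If $(i,j)\in D$, then $C_i\not\le_1 C_j$. In particular, whenever $u_i(k)\le u_j(k)$ for all $k\in\mathbb N$ and $(j,i)\in D$, one has $C_i<_1 C_j$.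
   Context: Sets $A\subseteq\mathbb N=\{0,1,\dots\}$ are identified with their characteristic functions: $A(x)=1$ if $x\in A$, $A(x)=0$ otherwise. $\emptyset'$ is the Turing jump of the empty set (the halting set). Intervals $[a,b)$ are intervals of natural numbers. A block-density profile is a total function $u:\mathbb N\to\mathbb Q\cap(1,2)$. A family $\{u_i\}_{i\in\mathbb N}$ of block-density profiles is uniformly computable if $(i,k)\mapsto u_i(k)$ is computable. Likewise the family $h_i$ is uniformly computable if $(i,x)\mapsto h_i(x)$ is computable, and "uniformly computably in $(i,j)$" means that $(i,j)\mapsto\delta_{i,j}$ and $(i,j,t)\mapsto s_{i,j}(t)$ are computable for $(i,j)\in D$. For $A,B\subseteq\mathbb N$: $A\le_1 B$ means there is a total computable injective $f:\mathbb N\to\mathbb N$ with $x\in A\iff f(x)\in B$ for all $x$. $A\le_{\rm bfo}B$ means there are a total computable $f:\mathbb N\to\mathbb N$ and a constant $c\ge1$ with $x\in A\iff f(x)\in B$ for all $x$ and $|f^{ -1}(y)|\le c$ for all $y\in\mathbb N$. For $r\in\{1,{\rm bfo}\}$, $A\equiv_r B$ means $A\le_r B$ and $B\le_r A$; $A<_r B$ means $A\le_r B$ and $B\not\le_r A$. -}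

module Defs where

open import Data.Fin.Base using (Fin; toℕ)
open import Data.Integer.Base using (ℤ; +_; -[1+_])
open import Data.List.Base using (length)
open import Data.List.Membership.Propositional using (_∈_)
open import Data.Nat.Base using (ℕ; zero; suc; _+_; _*_; _≤_; _<_; _!)
open import Data.Product.Base using (_×_; ∃-syntax)
open import Data.Rational.Base as ℚ using (ℚ; 1ℚ; ↥_; ↧ₙ_)
open import Data.Sum.Base using (_⊎_)
open import Data.Unit.Base using (⊤)
open import Data.Vec.Base using (Vec; []; _∷_; lookup)
open import Function.Bundles using (_⇔_)
open import Function.Definitions using (Injective)
open import Level using (0ℓ)
open import Relation.Binary.Core using (Rel)
open import Relation.Binary.PropositionalEquality.Core using (_≡_)
open import Relation.Nullary.Negation.Core using (¬_)
open import Relation.Unary using (Pred; ∅)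

private
  variable
    m n : ℕ

-- Kleene's μ-recursive function schemes with an oracle; `Prog n` is the
-- type of n-ary programs.

data Prog : ℕ → Set where
  zer    : Prog n
  succ   : Prog 1
  proj   : Fin n → Prog n
  comp   : Prog m → Vec (Prog n) m → Prog n
  prec   : Prog n → Prog (2 + n) → Prog (1 + n)
  mu     : Prog (1 + n) → Prog n
  oracle : Prog 1

-- `χ P b`: b is the value (1 for true, 0 for false) of the characteristic
-- function of a set at a point whose membership is expressed by P.

χ : Set → ℕ → Set
χ P b = (P × b ≡ 1) ⊎ (¬ P × b ≡ 0)

infix 4 _⊢_[_]⇓_ _⊢_[_]⇓*_

-- O ⊢ p [ xs ]⇓ y: with oracle O, program p halts on input xs with output y.

mutual

  data _⊢_[_]⇓_ (O : Pred ℕ 0ℓ) : Prog n → Vec ℕ n → ℕ → Set where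
    ⇓zer    : {xs : Vec ℕ n} → O ⊢ zer [ xs ]⇓ 0
    ⇓succ   : ∀ {x} → O ⊢ succ [ x ∷ [] ]⇓ suc x
    ⇓proj   : {xs : Vec ℕ n} (i : Fin n) → O ⊢ proj i [ xs ]⇓ lookup xs i
    ⇓comp   : {f : Prog m} {gs : Vec (Prog n) m} {xs : Vec ℕ n} {ys : Vec ℕ m} {z : ℕ} →
              O ⊢ gs [ xs ]⇓* ys → O ⊢ f [ ys ]⇓ z → O ⊢ comp f gs [ xs ]⇓ z
    ⇓prec₀  : {f : Prog n} {g : Prog (2 + n)} {xs : Vec ℕ n} {z : ℕ} →
              O ⊢ f [ xs ]⇓ z → O ⊢ prec f g [ 0 ∷ xs ]⇓ z
    ⇓precₛ  : {f : Prog n} {g : Prog (2 + n)} {xs : Vec ℕ n} {k y z : ℕ} →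
              O ⊢ prec f g [ k ∷ xs ]⇓ y → O ⊢ g [ k ∷ y ∷ xs ]⇓ z →
              O ⊢ prec f g [ suc k ∷ xs ]⇓ z
    ⇓mu     : {f : Prog (1 + n)} {xs : Vec ℕ n} {y : ℕ} →
              O ⊢ f [ y ∷ xs ]⇓ 0 →
              (∀ z → z < y → ∃[ w ] O ⊢ f [ z ∷ xs ]⇓ suc w) →
              O ⊢ mu f [ xs ]⇓ y
    ⇓oracle : ∀ {x b} → χ (O x) b → O ⊢ oracle [ x ∷ [] ]⇓ b

  data _⊢_[_]⇓*_ (O : Pred ℕ 0ℓ) : Vec (Prog n) m → Vec ℕ n → Vec ℕ m → Set where
    ⇓[] : {xs : Vec ℕ n} → O ⊢ [] [ xs ]⇓* []
    ⇓∷  : {g : Prog n} {gs : Vec (Prog n) m} {xs : Vec ℕ n} {y : ℕ} {ys : Vec ℕ m} →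
          O ⊢ g [ xs ]⇓ y → O ⊢ gs [ xs ]⇓* ys → O ⊢ g ∷ gs [ xs ]⇓* y ∷ ys

triangular : ℕ → ℕ
triangular zero    = 0
triangular (suc n) = suc n + triangular n

-- Cantor's pairing function

⟨_,_⟩ : ℕ → ℕ → ℕ
⟨ x , y ⟩ = triangular (x + y) + y

-- Gödel numbering, injective on Prog n for each n. The arity m in
-- `comp f gs` is not coded separately: it is the length of the list gs.

mutual

  ⌜_⌝ : Prog n → ℕ
  ⌜ zer ⌝       = ⟨ 0 , 0 ⟩
  ⌜ succ ⌝      = ⟨ 1 , 0 ⟩
  ⌜ proj i ⌝    = ⟨ 2 , toℕ i ⟩
  ⌜ comp f gs ⌝ = ⟨ 3 , ⟨ ⌜ f ⌝ , ⌜ gs ⌝* ⟩ ⟩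
  ⌜ prec f g ⌝  = ⟨ 4 , ⟨ ⌜ f ⌝ , ⌜ g ⌝ ⟩ ⟩
  ⌜ mu f ⌝      = ⟨ 5 , ⌜ f ⌝ ⟩
  ⌜ oracle ⌝    = ⟨ 6 , 0 ⟩

  ⌜_⌝* : Vec (Prog n) m → ℕ
  ⌜ [] ⌝*     = 0
  ⌜ g ∷ gs ⌝* = suc ⟨ ⌜ g ⌝ , ⌜ gs ⌝* ⟩

-- X ′ = { e : the program with number e, run with oracle X, halts on e }.
-- Numbers that code no program are not in X ′.

_′ : Pred ℕ 0ℓ → Pred ℕ 0ℓ
(X ′) e = ∃[ p ] (⌜ p ⌝ ≡ e × ∃[ y ] X ⊢ p [ e ∷ [] ]⇓ y)

∅′ : Pred ℕ 0ℓ
∅′ = ∅ ′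

_ComputableIn_ : Pred ℕ 0ℓ → Pred ℕ 0ℓ → Set
A ComputableIn O = ∃[ p ] ∀ x → ∃[ b ] (χ (A x) b × O ⊢ p [ x ∷ [] ]⇓ b)

-- Plain computability is computability with oracle ∅, where `oracle` is just
-- the constant function 0.

ComputableRel : Rel ℕ 0ℓ → Set
ComputableRel D = ∃[ p ] ∀ i j → ∃[ b ] (χ (D i j) b × ∅ ⊢ p [ i ∷ j ∷ [] ]⇓ b)

Computable : (ℕ → ℕ) → Set
Computable f = ∃[ p ] ∀ x → ∅ ⊢ p [ x ∷ [] ]⇓ f x

-- "Computable for (i , j) ∈ D": nothing is required of the program, nor of
-- the values of the function, at pairs outside D.

Computable₂On : Rel ℕ 0ℓ → (ℕ → ℕ → ℕ) → Set
Computable₂On D f = ∃[ p ] ∀ i j → D i j → ∅ ⊢ p [ i ∷ j ∷ [] ]⇓ f i j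

Computable₃On : Rel ℕ 0ℓ → (ℕ → ℕ → ℕ → ℕ) → Set
Computable₃On D f = ∃[ p ] ∀ i j → D i j → ∀ t → ∅ ⊢ p [ i ∷ j ∷ t ∷ [] ]⇓ f i j t

Computable₂ : (ℕ → ℕ → ℕ) → Set
Computable₂ = Computable₂On (λ _ _ → ⊤)

codeℤ : ℤ → ℕ
codeℤ (+ n)    = 2 * n
codeℤ -[1+ n ] = suc (2 * n)

-- A rational-valued function is computable when the numerator and the
-- denominator of its value in lowest terms are.

Computable₂ℚOn : Rel ℕ 0ℓ → (ℕ → ℕ → ℚ) → Set
Computable₂ℚOn D q =
  Computable₂On D (λ i j → codeℤ (↥ (q i j))) × Computable₂On D (λ i j → ↧ₙ (q i j))

Computable₂ℚ : (ℕ → ℕ → ℚ) → Set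
Computable₂ℚ = Computable₂ℚOn (λ _ _ → ⊤)

IsBlockDensityProfile : (ℕ → ℚ) → Set
IsBlockDensityProfile u = ∀ k → (1ℚ ℚ.< u k) × (u k ℚ.< (+ 2) ℚ./ 1)

Range : (ℕ → ℕ) → Pred ℕ 0ℓ
Range s k = ∃[ t ] s t ≡ k

Infinite : Pred ℕ 0ℓ → Set
Infinite S = ∀ n → ∃[ k ] (n ≤ k × S k)

-- |f⁻¹(y)| ≤ c for every y: each fibre is covered by a list of length at most c.

FibresBoundedBy : ℕ → (ℕ → ℕ) → Set
FibresBoundedBy c f =
  ∀ y → ∃[ xs ] (length {A = ℕ} xs ≤ c × (∀ x → f x ≡ y → x ∈ xs))

infix 4 _≤₁_ _≤bfo_ _≡bfo_ _<₁_

_≤₁_ : Rel (Pred ℕ 0ℓ) 0ℓ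
A ≤₁ B = ∃[ f ] (Computable f × Injective _≡_ _≡_ f × (∀ x → A x ⇔ B (f x)))

_≤bfo_ : Rel (Pred ℕ 0ℓ) 0ℓ
A ≤bfo B = ∃[ f ] (Computable f
                 × (∃[ c ] (1 ≤ c × FibresBoundedBy c f))
                 × (∀ x → A x ⇔ B (f x)))

_≡bfo_ : Rel (Pred ℕ 0ℓ) 0ℓ
A ≡bfo B = (A ≤bfo B) × (B ≤bfo A)

_<₁_ : Rel (Pred ℕ 0ℓ) 0ℓ
A <₁ B = (A ≤₁ B) × ¬ (B ≤₁ A)

blockStart : ℕ → ℕ
blockStart zero    = 0
blockStart (suc k) = blockStart k + k !

Block : ℕ → Pred ℕ 0ℓ
Block k x = blockStart k ≤ x × x < blockStart (suc k)

ConstantOn : Pred ℕ 0ℓ → Pred ℕ 0ℓ → Set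
ConstantOn S A = ∀ x y → S x → S y → A x ⇔ A y

{-# OPTIONS --safe #-}
module Submission where

-- Give block k of C_i the size N_i(k) = ⌈u_i(k) k!⌉ and the colour of block k
-- of A. If N_i ≤ N_j, blocks embed into blocks, which gives (d). If u_i(k)
-- exceeds u_j(k) by a fixed amount and k is large, then N_i(k) > Σ_{l ≤ k} N_j(l),
-- because Σ_{l < k} l! = o(k!); hence an injection must send some element of
-- block k of C_i into a block l > k of C_j. Such k and l can be found computably
-- above any n, say with l = R(n). The colouring K is built from ∅′ in stages so
-- that for every computable R with R(n) ≥ n there is an n with R(n) ∈ K and
-- [n , R(n)) disjoint from K; so blocks k and l get different colours, which
-- gives (e).

open import Defs
open import Axiom.ExcludedMiddle using (ExcludedMiddle)
open import Data.Nat.Base as ℕ using (ℕ)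
open import Data.Product.Base using (_×_; ∃-syntax)
open import Data.Rational.Base as ℚ using (ℚ; 0ℚ)
open import Function.Definitions using (StrictlySurjective)
open import Level using (0ℓ)
open import Relation.Binary.Core using (Rel; _Preserves_⟶_)
open import Relation.Binary.PropositionalEquality.Core using (_≡_)
open import Relation.Nullary.Negation.Core using (¬_)
open import Relation.Unary using (Pred)

open import Data.Empty using (⊥-elim)
open import Data.Fin.Base using (Fin; zero; suc; toℕ; fromℕ<)
open import Data.Fin.Properties
  using (toℕ-injective; toℕ<n; toℕ-fromℕ<; pigeonhole; ¬∀⟶∃¬)
open import Data.Integer.Base as ℤ using (-[1+_]; +[1+_]; +0; ∣_∣)
open import Data.Integer.Properties using (drop‿+≤+; pos-*; pos-+)
open import Data.List.Base using (List) renaming ([] to []ᴸ; _∷_ to _∷ᴸ_)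
open import Data.List.Membership.Propositional using (_∈_)
open import Data.List.Relation.Unary.Any using (here; there)
open import Data.Nat.Base
  using (zero; suc; _+_; _*_; _∸_; _≤_; _<_; _!; z≤n; s≤s; pred)
open import Data.Nat.Properties
open import Data.Nat.Solver using (module +-*-Solver)
open import Data.Product.Base using (_,_; proj₁; proj₂)
open import Data.Rational.Base using (1ℚ; ↥_; ↧_; ↧ₙ_)
import Data.Rational.Properties as ℚ
import Data.Rational.Unnormalised.Base as ℚᵘ
import Data.Rational.Unnormalised.Properties as ℚᵘ
open import Data.Sum.Base using (_⊎_; inj₁; inj₂)
open import Data.Unit.Base using (tt)
open import Data.Vec.Base using (Vec; []; _∷_; lookup)
open import Function.Base using (case_of_; id)
open import Function.Bundles using (_⇔_; mk⇔; Equivalence)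
open import Function.Construct.Composition using (_⇔-∘_)
open import Function.Construct.Symmetry using (⇔-sym)
open import Function.Definitions using (Injective)
open import Relation.Binary.Definitions using (tri<; tri≈; tri>)
open import Relation.Binary.PropositionalEquality
  using (refl; sym; trans; cong; cong₂; subst; subst₂)
open import Relation.Nullary.Decidable using (yes; no)
open import Relation.Unary using (∅)

-- Computable functions

-- Convergence of a program is undecidable, and its value is not known in advance. The oracle
-- settles both: for growing b it is asked whether program e halts on n with a value of at least b.
-- Each of these is a halting question, and finitely many of them determine a stage. The whole
-- interval [n , R(n)) is left uncoloured because the block k that is escaped from is only known to
-- satisfy n ≤ k < R(n). Densities between 1 and 2 give block k of C_i between k! and 2 k! elements,
-- so it can be wrapped onto I_k, covering it entirely and no point more than twice. This wrapping
-- is `h i`; since it preserves block numbers, C_i is the same colouring spread over blocks of other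
-- sizes. Excluded middle enters only in supplying the answers of the oracle and the end of the
-- search in each stage.

record Rec (O : Pred ℕ 0ℓ) {n : ℕ} (f : Vec ℕ n → ℕ) : Set where
  constructor rec
  field
    prog : Prog n
    runs : ∀ xs → O ⊢ prog [ xs ]⇓ f xs

-- `Rec` speaks of functions of an environment, with `var` for its variables. The curried forms hold
-- named functions, which `app₁`, `app₂` and `app₃` place inside larger expressions.
record Rec₁ (O : Pred ℕ 0ℓ) (F : ℕ → ℕ) : Set where
  constructor rec
  field
    prog : Prog 1
    runs : ∀ x → O ⊢ prog [ x ∷ [] ]⇓ F x

record Rec₂ (O : Pred ℕ 0ℓ) (F : ℕ → ℕ → ℕ) : Set where
  constructor rec
  field
    prog : Prog 2
    runs : ∀ x y → O ⊢ prog [ x ∷ y ∷ [] ]⇓ F x y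

record Rec₃ (O : Pred ℕ 0ℓ) (F : ℕ → ℕ → ℕ → ℕ) : Set where
  constructor rec
  field
    prog : Prog 3
    runs : ∀ x y z → O ⊢ prog [ x ∷ y ∷ z ∷ [] ]⇓ F x y z

const : ∀ {n} → ℕ → Prog n
const zero    = zer
const (suc c) = comp succ (const c ∷ [])

const-runs : ∀ {O n} c {xs : Vec ℕ n} → O ⊢ const c [ xs ]⇓ c
const-runs zero    = ⇓zer
const-runs (suc c) = ⇓comp (⇓∷ (const-runs c) ⇓[]) ⇓succ

-- Mirrors the premises of `⇓mu`. Every unbounded search below is put in this form, so that one
-- witness serves both the mathematics and the run of the program.
IsLeastZero : (ℕ → ℕ) → ℕ → Set
IsLeastZero f d = f d ≡ 0 × (∀ z → z < d → ∃[ w ] f z ≡ suc w)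

leastZero : (f : ℕ → ℕ) (d : ℕ) → f d ≡ 0 → ∃[ e ] IsLeastZero f e
leastZero f zero    fd = 0 , fd , λ _ ()
leastZero f (suc d) fd with f 0 in f0
... | zero  = 0 , f0 , λ _ ()
... | suc w with leastZero (λ z → f (suc z)) d fd
...   | e , fe , below = suc e , fe , λ where
        zero    _         → w , f0
        (suc z) (s≤s z<e) → below z z<e

module _ {O : Pred ℕ 0ℓ} where

  var : ∀ {n} (i : Fin n) → Rec O (λ xs → lookup xs i)
  var i = rec (proj i) (λ _ → ⇓proj i)

  lit : ∀ {n} (c : ℕ) → Rec O {n} (λ _ → c)
  lit c = rec (const c) (λ _ → const-runs c)

  module _ {n : ℕ} where

    app₁ : ∀ {F} {f : Vec ℕ n → ℕ} → Rec₁ O F → Rec O f → Rec O (λ xs → F (f xs))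
    app₁ (rec p p⇓) (rec q q⇓) =
      rec (comp p (q ∷ [])) (λ xs → ⇓comp (⇓∷ (q⇓ xs) ⇓[]) (p⇓ _))

    app₂ : ∀ {F} {f g : Vec ℕ n → ℕ} → Rec₂ O F → Rec O f → Rec O g →
           Rec O (λ xs → F (f xs) (g xs))
    app₂ (rec p p⇓) (rec q q⇓) (rec r r⇓) =
      rec (comp p (q ∷ r ∷ [])) (λ xs → ⇓comp (⇓∷ (q⇓ xs) (⇓∷ (r⇓ xs) ⇓[])) (p⇓ _ _))

    app₃ : ∀ {F} {f g h : Vec ℕ n → ℕ} → Rec₃ O F → Rec O f → Rec O g → Rec O h →
           Rec O (λ xs → F (f xs) (g xs) (h xs))
    app₃ (rec p p⇓) (rec q q⇓) (rec r r⇓) (rec s s⇓) =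
      rec (comp p (q ∷ r ∷ s ∷ []))
          (λ xs → ⇓comp (⇓∷ (q⇓ xs) (⇓∷ (r⇓ xs) (⇓∷ (s⇓ xs) ⇓[]))) (p⇓ _ _ _))

  fun₁ : ∀ {F} → Rec O {1} (λ xs → F (lookup xs zero)) → Rec₁ O F
  fun₁ (rec p p⇓) = rec p (λ x → p⇓ (x ∷ []))

  fun₂ : ∀ {F} → Rec O {2} (λ xs → F (lookup xs zero) (lookup xs (suc zero))) → Rec₂ O F
  fun₂ (rec p p⇓) = rec p (λ x y → p⇓ (x ∷ y ∷ []))

  fun₃ : ∀ {F} → Rec O {3} (λ xs → F (lookup xs zero) (lookup xs (suc zero)) (lookup xs (suc (suc zero)))) →
         Rec₃ O F
  fun₃ (rec p p⇓) = rec p (λ x y z → p⇓ (x ∷ y ∷ z ∷ []))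

  prec₁ : ∀ {F} {g : Vec ℕ 2 → ℕ} → Rec O g →
          (∀ k → F (suc k) ≡ g (k ∷ F k ∷ [])) → Rec₁ O F
  prec₁ {F} {g} (rec q q⇓) Fₛ = rec (prec (const (F 0)) q) runs
    where
    runs : ∀ k → O ⊢ prec (const (F 0)) q [ k ∷ [] ]⇓ F k
    runs zero    = ⇓prec₀ (const-runs (F 0))
    runs (suc k) rewrite Fₛ k = ⇓precₛ (runs k) (q⇓ _)

  -- Recursion is on the second argument, whereas `prec` recurses on the first; hence the exchanged
  -- projections.
  prec₂ : ∀ {F} {z : Vec ℕ 1 → ℕ} {g : Vec ℕ 3 → ℕ} → Rec O z → Rec O g →
          (∀ x → F x 0 ≡ z (x ∷ [])) →
          (∀ x k → F x (suc k) ≡ g (k ∷ F x k ∷ x ∷ [])) → Rec₂ O F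
  prec₂ {F} (rec p p⇓) (rec q q⇓) F₀ Fₛ =
    rec (comp (prec p q) (proj (suc zero) ∷ proj zero ∷ []))
        (λ x k → ⇓comp (⇓∷ (⇓proj (suc zero)) (⇓∷ (⇓proj zero) ⇓[])) (runs x k))
    where
    runs : ∀ x k → O ⊢ prec p q [ k ∷ x ∷ [] ]⇓ F x k
    runs x zero    rewrite F₀ x   = ⇓prec₀ (p⇓ _)
    runs x (suc k) rewrite Fₛ x k = ⇓precₛ (runs x k) (q⇓ _)

  mu-runs : ∀ {n} {g : Vec ℕ (suc n) → ℕ} (r : Rec O g) (xs : Vec ℕ n) {d : ℕ} →
            IsLeastZero (λ z → g (z ∷ xs)) d → O ⊢ mu (Rec.prog r) [ xs ]⇓ d
  mu-runs (rec p p⇓) xs (zero-at-d , below) =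
    ⇓mu (subst (O ⊢ p [ _ ]⇓_) zero-at-d (p⇓ _))
        (λ z z<d → let w , eq = below z z<d in w , subst (O ⊢ p [ _ ]⇓_) eq (p⇓ _))

  mu₁ : ∀ {F} {g : Vec ℕ 2 → ℕ} → Rec O g →
        (∀ x → IsLeastZero (λ z → g (z ∷ x ∷ [])) (F x)) → Rec₁ O F
  mu₁ r least = rec (mu (Rec.prog r)) (λ x → mu-runs r (x ∷ []) (least x))

  mu₂ : ∀ {F} {g : Vec ℕ 3 → ℕ} → Rec O g →
        (∀ x y → IsLeastZero (λ z → g (z ∷ x ∷ y ∷ [])) (F x y)) → Rec₂ O F
  mu₂ r least = rec (mu (Rec.prog r)) (λ x y → mu-runs r (x ∷ y ∷ []) (least x y))

  suc-rec : Rec₁ O suc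
  suc-rec = rec succ (λ _ → ⇓succ)

  pred-rec : Rec₁ O pred
  pred-rec = prec₁ (var zero) (λ _ → refl)

  +-rec : Rec₂ O _+_
  +-rec = prec₂ (var zero) (app₁ suc-rec (var (suc zero))) +-identityʳ +-suc

  *-rec : Rec₂ O _*_
  *-rec = prec₂ (lit 0) (app₂ +-rec (var (suc (suc zero))) (var (suc zero))) *-zeroʳ *-suc

  ∸-rec : Rec₂ O _∸_
  ∸-rec = prec₂ (var zero) (app₁ pred-rec (var (suc zero))) (λ _ → refl) ∸-suc
    where
    ∸-suc : ∀ x k → x ∸ suc k ≡ pred (x ∸ k)
    ∸-suc zero    zero    = refl
    ∸-suc zero    (suc k) = refl
    ∸-suc (suc x) zero    = refl
    ∸-suc (suc x) (suc k) = ∸-suc x k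

  !-rec : Rec₁ O _!
  !-rec = prec₁ (app₂ *-rec (app₁ suc-rec (var zero)) (var (suc zero))) (λ _ → refl)

  triangular-rec : Rec₁ O triangular
  triangular-rec =
    prec₁ (app₂ +-rec (app₁ suc-rec (var zero)) (var (suc zero))) (λ _ → refl)

  ⟨,⟩-rec : Rec₂ O ⟨_,_⟩
  ⟨,⟩-rec = fun₂ (app₂ +-rec (app₁ triangular-rec (app₂ +-rec (var zero) (var (suc zero))))
                             (var (suc zero)))

  section : ∀ {F} → Rec₂ O F → ∀ x → Rec₁ O (F x)
  section r x = fun₁ (app₂ r (lit x) (var zero))

-- Division of ℕ into consecutive blocks

InBlock : (ℕ → ℕ) → ℕ → ℕ → Set
InBlock start k x = start k ≤ x × x < start (suc k)

IsPartition : (ℕ → ℕ) → Set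
IsPartition start = start 0 ≡ 0 × (∀ k → start k < start (suc k))

-- A primitive recursion, hence computable: the truncated difference is 1 exactly when `suc x` has
-- reached the start of the next block. One increment suffices because blocks are non-empty.
index : (ℕ → ℕ) → ℕ → ℕ
index start zero    = 0
index start (suc x) = (1 ∸ (start (suc (index start x)) ∸ suc x)) + index start x

module _ {start : ℕ → ℕ} (partition : IsPartition start) where

  private
    start-mono-≤ : ∀ {k l} → k ≤ l → start k ≤ start l
    start-mono-≤ {l = zero}  z≤n = ≤-refl
    start-mono-≤ {k} {suc l} k≤1+l with m≤n⇒m<n∨m≡n k≤1+l
    ... | inj₁ (s≤s k≤l) = ≤-trans (start-mono-≤ k≤l) (<⇒≤ (proj₂ partition l))
    ... | inj₂ refl      = ≤-refl

  start-cancel-< : ∀ {k l x} → start k ≤ x → x < start l → k < l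
  start-cancel-< {k} {l} s≤x x<s with k <? l
  ... | yes k<l = k<l
  ... | no  k≮l = ⊥-elim (<-irrefl refl (≤-<-trans s≤x (<-≤-trans x<s (start-mono-≤ (≮⇒≥ k≮l)))))

  index-InBlock : ∀ x → InBlock start (index start x) x
  index-InBlock zero    = ≤-reflexive (proj₁ partition) , ≤-<-trans z≤n (proj₂ partition 0)
  index-InBlock (suc x) with index-InBlock x | start (suc (index start x)) ≤? suc x
  ... | lo , hi | yes s≤x rewrite m≤n⇒m∸n≡0 s≤x = s≤x , ≤-<-trans hi (proj₂ partition _)
  ... | lo , hi | no  s≰x rewrite m≤n⇒m∸n≡0 (m<n⇒0<n∸m (≰⇒> s≰x)) = m≤n⇒m≤1+n lo , ≰⇒> s≰x

  InBlock-unique : ∀ {k l x} → InBlock start k x → InBlock start l x → k ≡ l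
  InBlock-unique (kx , xk) (lx , xl) =
    ≤-antisym (≤-pred (start-cancel-< kx xl)) (≤-pred (start-cancel-< lx xk))

  InBlock⇒index : ∀ {k x} → InBlock start k x → index start x ≡ k
  InBlock⇒index = InBlock-unique (index-InBlock _)

index-rec : ∀ {O start} → Rec₂ O start → Rec₂ O (λ i → index (start i))
index-rec start-rec =
  prec₂ (lit 0)
        (app₂ +-rec (app₂ ∸-rec (lit 1)
                      (app₂ ∸-rec (app₂ start-rec (var (suc (suc zero))) (app₁ suc-rec (var (suc zero))))
                                  (app₁ suc-rec (var zero))))
                    (var (suc zero)))
        (λ _ → refl) (λ _ _ → refl)

-- Programs and their codes

-- The triangular numbers cut ℕ into blocks, and the pair of a and b lies in block a + b. Uniqueness
-- of the block yields the sum, and the offset within it is the second component.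
⟨,⟩-injective : ∀ x y x′ y′ → ⟨ x , y ⟩ ≡ ⟨ x′ , y′ ⟩ → x ≡ x′ × y ≡ y′
⟨,⟩-injective x y x′ y′ eq = +-cancelʳ-≡ y x x′ (trans sums (cong (x′ +_) (sym y≡y′))) , y≡y′
  where
  inBlock : ∀ a b → InBlock triangular (a + b) ⟨ a , b ⟩
  inBlock a b = m≤m+n _ b ,
    s≤s (≤-trans (≤-reflexive (+-comm (triangular (a + b)) b)) (+-monoˡ-≤ _ (m≤n+m b a)))

  sums : x + y ≡ x′ + y′
  sums = InBlock-unique {triangular} (refl , λ k → s≤s (m≤n+m _ k)) (inBlock x y)
           (subst (InBlock triangular (x′ + y′)) (sym eq) (inBlock x′ y′))

  y≡y′ : y ≡ y′
  y≡y′ = +-cancelˡ-≡ (triangular (x + y)) y y′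
           (trans eq (cong (λ s → triangular s + y′) (sym sums)))

tag : ∀ {n} → Prog n → ℕ
tag zer        = 0
tag succ       = 1
tag (proj _)   = 2
tag (comp _ _) = 3
tag (prec _ _) = 4
tag (mu _)     = 5
tag oracle     = 6

body : ∀ {n} → Prog n → ℕ
body zer         = 0
body succ        = 0
body (proj i)    = toℕ i
body (comp f gs) = ⟨ ⌜ f ⌝ , ⌜ gs ⌝* ⟩
body (prec f g)  = ⟨ ⌜ f ⌝ , ⌜ g ⌝ ⟩
body (mu f)      = ⌜ f ⌝
body oracle      = 0

⌜⌝-⟨tag,body⟩ : ∀ {n} (p : Prog n) → ⌜ p ⌝ ≡ ⟨ tag p , body p ⟩
⌜⌝-⟨tag,body⟩ zer        = refl
⌜⌝-⟨tag,body⟩ succ       = refl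
⌜⌝-⟨tag,body⟩ (proj _)   = refl
⌜⌝-⟨tag,body⟩ (comp _ _) = refl
⌜⌝-⟨tag,body⟩ (prec _ _) = refl
⌜⌝-⟨tag,body⟩ (mu _)     = refl
⌜⌝-⟨tag,body⟩ oracle     = refl

-- The inner arity of `comp` is hidden in its type; it has to be identified before the two lists of
-- programs can be compared at all.
⌜⌝*-length : ∀ {n k l} (gs : Vec (Prog n) k) (hs : Vec (Prog n) l) → ⌜ gs ⌝* ≡ ⌜ hs ⌝* → k ≡ l
⌜⌝*-length []       []       _  = refl
⌜⌝*-length (g ∷ gs) (h ∷ hs) eq =
  cong suc (⌜⌝*-length gs hs (proj₂ (⟨,⟩-injective ⌜ g ⌝ ⌜ gs ⌝* ⌜ h ⌝ ⌜ hs ⌝* (suc-injective eq))))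

mutual

  ⌜⌝-injective : ∀ {n} (p q : Prog n) → ⌜ p ⌝ ≡ ⌜ q ⌝ → p ≡ q
  ⌜⌝-injective p q eq =
    let tags , bodies = ⟨,⟩-injective (tag p) (body p) (tag q) (body q)
                          (trans (sym (⌜⌝-⟨tag,body⟩ p)) (trans eq (⌜⌝-⟨tag,body⟩ q)))
    in tag-body-injective p q tags bodies

  tag-body-injective : ∀ {n} (p q : Prog n) → tag p ≡ tag q → body p ≡ body q → p ≡ q
  tag-body-injective zer         zer          refl _  = refl
  tag-body-injective succ        succ         refl _  = refl
  tag-body-injective (proj i)    (proj j)     refl eq = cong proj (toℕ-injective eq)
  tag-body-injective (comp f gs) (comp f′ gs′) refl eq
    with f≡ , gs≡ ← ⟨,⟩-injective ⌜ f ⌝ ⌜ gs ⌝* ⌜ f′ ⌝ ⌜ gs′ ⌝* eq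
    with refl ← ⌜⌝*-length gs gs′ gs≡ =
    cong₂ comp (⌜⌝-injective f f′ f≡) (⌜⌝*-injective gs gs′ gs≡)
  tag-body-injective (prec f g)  (prec f′ g′) refl eq =
    let f≡ , g≡ = ⟨,⟩-injective ⌜ f ⌝ ⌜ g ⌝ ⌜ f′ ⌝ ⌜ g′ ⌝ eq
    in cong₂ prec (⌜⌝-injective f f′ f≡) (⌜⌝-injective g g′ g≡)
  tag-body-injective (mu f)      (mu f′)      refl eq = cong mu (⌜⌝-injective f f′ eq)
  tag-body-injective oracle      oracle       refl _  = refl

  ⌜⌝*-injective : ∀ {n m} (gs hs : Vec (Prog n) m) → ⌜ gs ⌝* ≡ ⌜ hs ⌝* → gs ≡ hs
  ⌜⌝*-injective []       []       _  = refl
  ⌜⌝*-injective (g ∷ gs) (h ∷ hs) eq =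
    let g≡ , gs≡ = ⟨,⟩-injective ⌜ g ⌝ ⌜ gs ⌝* ⌜ h ⌝ ⌜ hs ⌝* (suc-injective eq)
    in cong₂ _∷_ (⌜⌝-injective g h g≡) (⌜⌝*-injective gs hs gs≡)

mutual

  ⇓-deterministic : ∀ {O n} {p : Prog n} {xs y z} → O ⊢ p [ xs ]⇓ y → O ⊢ p [ xs ]⇓ z → y ≡ z
  ⇓-deterministic ⇓zer        ⇓zer        = refl
  ⇓-deterministic ⇓succ       ⇓succ       = refl
  ⇓-deterministic (⇓proj i)   (⇓proj .i)  = refl
  ⇓-deterministic (⇓comp a b) (⇓comp c d) with refl ← ⇓*-deterministic a c = ⇓-deterministic b d
  ⇓-deterministic (⇓prec₀ a)  (⇓prec₀ b)  = ⇓-deterministic a b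
  ⇓-deterministic (⇓precₛ a b) (⇓precₛ c d) with refl ← ⇓-deterministic a c = ⇓-deterministic b d
  ⇓-deterministic (⇓mu {y = y} a below) (⇓mu {y = z} b below′) with <-cmp y z
  ... | tri< y<z _ _ with () ← ⇓-deterministic a (proj₂ (below′ y y<z))
  ... | tri≈ _ y≡z _ = y≡z
  ... | tri> _ _ z<y with () ← ⇓-deterministic (proj₂ (below z z<y)) b
  ⇓-deterministic (⇓oracle (inj₁ (_ , refl))) (⇓oracle (inj₁ (_ , refl))) = refl
  ⇓-deterministic (⇓oracle (inj₁ (x , _)))    (⇓oracle (inj₂ (¬x , _)))   = ⊥-elim (¬x x)
  ⇓-deterministic (⇓oracle (inj₂ (¬x , _)))   (⇓oracle (inj₁ (x , _)))    = ⊥-elim (¬x x)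
  ⇓-deterministic (⇓oracle (inj₂ (_ , refl))) (⇓oracle (inj₂ (_ , refl))) = refl

  ⇓*-deterministic : ∀ {O n m} {gs : Vec (Prog n) m} {xs ys zs} →
                     O ⊢ gs [ xs ]⇓* ys → O ⊢ gs [ xs ]⇓* zs → ys ≡ zs
  ⇓*-deterministic ⇓[]      ⇓[]      = refl
  ⇓*-deterministic (⇓∷ a b) (⇓∷ c d) = cong₂ _∷_ (⇓-deterministic a c) (⇓*-deterministic b d)

-- Codes of composite programs

-- Cantor's pairing is sealed off, for the type checker would otherwise unfold
-- the arithmetic of nested pairs.
abstract

  pair : ℕ → ℕ → ℕ
  pair = ⟨_,_⟩

  pair-rec : ∀ {O} → Rec₂ O pair
  pair-rec = ⟨,⟩-rec

  pair-injective : ∀ x y x′ y′ → pair x y ≡ pair x′ y′ → x ≡ x′ × y ≡ y′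
  pair-injective = ⟨,⟩-injective

  ⌜⌝-pair : ∀ {n} (p : Prog n) → ⌜ p ⌝ ≡ pair (tag p) (body p)
  ⌜⌝-pair = ⌜⌝-⟨tag,body⟩

  ⟨,⟩≡pair : ∀ x y → ⟨ x , y ⟩ ≡ pair x y
  ⟨,⟩≡pair _ _ = refl

  monus : Rec₂ ∅ _∸_
  monus = ∸-rec

-- Here 3 is the tag of `comp`, and `suc (pair c 0)` codes the one-element list of the program with
-- code c.
comp₁-code : ℕ → ℕ → ℕ
comp₁-code e c = pair 3 (pair e (suc (pair c 0)))

body-comp₁ : ∀ {n} (f : Prog 1) (g : Prog n) →
             body (comp f (g ∷ [])) ≡ pair ⌜ f ⌝ (suc (pair ⌜ g ⌝ 0))
body-comp₁ f g = trans (⟨,⟩≡pair ⌜ f ⌝ ⌜ g ∷ [] ⌝*)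
                       (cong (λ c → pair ⌜ f ⌝ (suc c)) (⟨,⟩≡pair ⌜ g ⌝ 0))

⌜comp₁⌝ : ∀ {n} (f : Prog 1) (g : Prog n) → ⌜ comp f (g ∷ []) ⌝ ≡ comp₁-code ⌜ f ⌝ ⌜ g ⌝
⌜comp₁⌝ f g = trans (⌜⌝-pair (comp f (g ∷ []))) (cong (pair 3) (body-comp₁ f g))

-- Membership in ∅′ provides some program with a given code; inversion recovers its shape. The list
-- of arguments has length one because the code of a non-empty tail would be a successor.
comp₁-code-inversion : ∀ {n} (p : Prog n) e c → ⌜ p ⌝ ≡ comp₁-code e c →
                       ∃[ f ] ∃[ g ] (p ≡ comp f (g ∷ []) × ⌜ f ⌝ ≡ e × ⌜ g ⌝ ≡ c)
comp₁-code-inversion p e c eq =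
  let tags , bodies = pair-injective (tag p) (body p) 3 (pair e (suc (pair c 0)))
                        (trans (sym (⌜⌝-pair p)) eq)
  in helper p tags bodies
  where
  helper : ∀ {n} (p : Prog n) → tag p ≡ 3 → body p ≡ pair e (suc (pair c 0)) →
           ∃[ f ] ∃[ g ] (p ≡ comp f (g ∷ []) × ⌜ f ⌝ ≡ e × ⌜ g ⌝ ≡ c)
  helper (comp f gs) _ eq
    with pair-injective ⌜ f ⌝ ⌜ gs ⌝* e (suc (pair c 0)) (trans (sym (⟨,⟩≡pair ⌜ f ⌝ ⌜ gs ⌝*)) eq)
  helper (comp f [])       _ _ | _  , ()
  helper (comp f (g ∷ gs)) _ _ | f≡ , gs≡
    with pair-injective ⌜ g ⌝ ⌜ gs ⌝* c 0
           (trans (sym (⟨,⟩≡pair ⌜ g ⌝ ⌜ gs ⌝*)) (suc-injective gs≡))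
  helper (comp f (g ∷ [])) _ _ | f≡ , _ | g≡ , _ = f , g , refl , f≡ , g≡

constCode : ℕ → ℕ
constCode zero    = 0
constCode (suc c) = comp₁-code ⌜ succ ⌝ (constCode c)

⌜const⌝ : ∀ {n} c → ⌜ const {n} c ⌝ ≡ constCode c
⌜const⌝ zero    = refl
⌜const⌝ (suc c) = trans (⌜comp₁⌝ succ (const c)) (cong (comp₁-code ⌜ succ ⌝) (⌜const⌝ c))

-- Halts exactly on the inputs ≥ b.
atLeast : ℕ → Prog 1
atLeast b = mu (comp (Rec₂.prog monus) (const b ∷ proj (suc zero) ∷ []))

atLeastShape : ℕ → ℕ
atLeastShape c =
  pair 5 (pair 3 (pair ⌜ Rec₂.prog monus ⌝ (suc (pair c ⌜ proj {2} (suc zero) ∷ [] ⌝*))))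

atLeastCode : ℕ → ℕ
atLeastCode b = atLeastShape (constCode b)

⌜atLeast⌝ : ∀ b → ⌜ atLeast b ⌝ ≡ atLeastCode b
⌜atLeast⌝ b =
  trans (⌜⌝-pair (atLeast b))
    (trans (cong (pair 5)
      (trans (⌜⌝-pair (comp (Rec₂.prog monus) (const b ∷ proj (suc zero) ∷ [])))
             (cong (pair 3)
               (trans (⟨,⟩≡pair ⌜ Rec₂.prog monus ⌝ ⌜ const {2} b ∷ proj (suc zero) ∷ [] ⌝*)
                      (cong (λ c → pair ⌜ Rec₂.prog monus ⌝ (suc c))
                            (⟨,⟩≡pair ⌜ const {2} b ⌝ ⌜ proj {2} (suc zero) ∷ [] ⌝*))))))
      (cong atLeastShape (⌜const⌝ b)))

-- The jump runs a program on its own code. The program coded here discards its input in favour of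
-- the constant n, so self-application does no harm.
queryCode : ℕ → ℕ → ℕ → ℕ
queryCode e n b = comp₁-code (atLeastCode b) (comp₁-code e (constCode n))

module _ {O : Pred ℕ 0ℓ} where

  comp₁-code-rec : Rec₂ O comp₁-code
  comp₁-code-rec =
    fun₂ (app₂ pair-rec (lit 3)
           (app₂ pair-rec (var zero) (app₁ suc-rec (app₂ pair-rec (var (suc zero)) (lit 0)))))

  constCode-rec : Rec₁ O constCode
  constCode-rec = prec₁ (app₂ comp₁-code-rec (lit ⌜ succ ⌝) (var (suc zero))) (λ _ → refl)

  atLeastCode-rec : Rec₁ O atLeastCode
  atLeastCode-rec =
    fun₁ (app₂ pair-rec (lit 5) (app₂ pair-rec (lit 3)
      (app₂ pair-rec (lit ⌜ Rec₂.prog monus ⌝)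
        (app₁ suc-rec (app₂ pair-rec (app₁ constCode-rec (var zero))
                                     (lit ⌜ proj {2} (suc zero) ∷ [] ⌝*))))))

  queryCode-rec : Rec₃ O queryCode
  queryCode-rec =
    fun₃ (app₂ comp₁-code-rec (app₁ atLeastCode-rec (var (suc (suc zero))))
            (app₂ comp₁-code-rec (var zero) (app₁ constCode-rec (var (suc zero)))))

-- A ∅′-computable set that is generic for computable functions

-- The test b ∸ y ignores the search variable, so the search ends at 0 or never.
atLeast-halts : ∀ {b y} → b ≤ y → ∅ ⊢ atLeast b [ y ∷ [] ]⇓ 0
atLeast-halts {b} {y} b≤y =
  ⇓mu (⇓comp (⇓∷ (const-runs b) (⇓∷ (⇓proj (suc zero)) ⇓[]))
             (subst (∅ ⊢ Rec₂.prog monus [ b ∷ y ∷ [] ]⇓_) (m≤n⇒m∸n≡0 b≤y) (Rec₂.runs monus b y)))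
      (λ _ ())

atLeast-halts⁻¹ : ∀ {b y z} → ∅ ⊢ atLeast b [ y ∷ [] ]⇓ z → b ≤ y
atLeast-halts⁻¹ {b} {y} (⇓mu (⇓comp (⇓∷ b⇓ (⇓∷ (⇓proj _) ⇓[])) monus⇓) _)
  with refl ← ⇓-deterministic b⇓ (const-runs b) =
  m∸n≡0⇒m≤n (⇓-deterministic (Rec₂.runs monus b y) monus⇓)

HaltsAbove : ℕ → ℕ → ℕ → Set
HaltsAbove e n b = ∃[ r ] (⌜ r ⌝ ≡ e × ∃[ y ] (∅ ⊢ r [ n ∷ [] ]⇓ y × b ≤ y))

HaltsAbove⇒∅′ : ∀ e n b → HaltsAbove e n b → ∅′ (queryCode e n b)
HaltsAbove⇒∅′ e n b (r , refl , y , r⇓ , b≤y) =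
  comp (atLeast b) (comp r (const n ∷ []) ∷ []) ,
  trans (⌜comp₁⌝ (atLeast b) (comp r (const n ∷ [])))
        (cong₂ comp₁-code (⌜atLeast⌝ b)
                          (trans (⌜comp₁⌝ r (const n)) (cong (comp₁-code ⌜ r ⌝) (⌜const⌝ n)))) ,
  0 , ⇓comp (⇓∷ (⇓comp (⇓∷ (const-runs n) ⇓[]) r⇓) ⇓[]) (atLeast-halts b≤y)

∅′⇒HaltsAbove : ∀ e n b → ∅′ (queryCode e n b) → HaltsAbove e n b
∅′⇒HaltsAbove e n b (p , p≡ , z , p⇓) =
  let f , g , p=comp , f≡ , g≡ = comp₁-code-inversion p (atLeastCode b) (comp₁-code e (constCode n)) p≡
      r , c , g=comp , r≡ , c≡ = comp₁-code-inversion g e (constCode n) g≡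
      f= = ⌜⌝-injective f (atLeast b) (trans f≡ (sym (⌜atLeast⌝ b)))
      c= = ⌜⌝-injective c (const n) (trans c≡ (sym (⌜const⌝ n)))
      g= = trans g=comp (cong (λ c → comp r (c ∷ [])) c=)
      p= = trans p=comp (cong₂ (λ f g → comp f (g ∷ [])) f= g=)
  in r , r≡ , query-halts r (subst (∅ ⊢_[ _ ]⇓ z) p= p⇓)
  where
  query-halts : ∀ r {xs z} → ∅ ⊢ comp (atLeast b) (comp r (const n ∷ []) ∷ []) [ xs ]⇓ z →
                ∃[ y ] (∅ ⊢ r [ n ∷ [] ]⇓ y × b ≤ y)
  query-halts r (⇓comp (⇓∷ (⇓comp (⇓∷ n⇓ ⇓[]) r⇓) ⇓[]) b⇓)
    with refl ← ⇓-deterministic n⇓ (const-runs n) = _ , r⇓ , atLeast-halts⁻¹ b⇓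

-- The second component confines g to the values 0 and 1. The third makes the colour of `R n` differ
-- from that of every k with n ≤ k < R n.
IsGeneric : (ℕ → ℕ) → Set
IsGeneric g = Rec₁ ∅′ g
            × (∀ x → χ (g x ≡ 1) (g x))
            × ((R : ℕ → ℕ) → Rec₁ ∅ R → (∀ n → n ≤ R n) →
               ∃[ n ] (g (R n) ≡ 1 × (∀ x → n ≤ x → x < R n → g x ≡ 0)))

module Generic
  (em : ExcludedMiddle 0ℓ)
  (query : ℕ → ℕ → ℕ → ℕ)
  (query-rec : Rec₃ ∅′ query)
  (HaltsAbove⇒query : ∀ e n b → HaltsAbove e n b → ∅′ (query e n b))
  (query⇒HaltsAbove : ∀ e n b → ∅′ (query e n b) → HaltsAbove e n b)
  where

  halting : ℕ → ℕ
  halting c with em {∅′ c}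
  ... | yes _ = 1
  ... | no  _ = 0

  χ-halting : ∀ c → χ (∅′ c) (halting c)
  χ-halting c with em {∅′ c}
  ... | yes c∈ = inj₁ (c∈ , refl)
  ... | no  c∉ = inj₂ (c∉ , refl)

  -- Finds whether, and where, program e halts on input n: if its value is
  -- y ≥ n, then `probe e n` has its first zero at y ∸ n.
  probe : ℕ → ℕ → ℕ → ℕ
  probe e n d = halting (query e n (suc (d + n)))

  -- Keeps the stages total: if e codes no unary program, or one that diverges on n, already the
  -- query at d = 0 fails; if the value is y, the query at d = y fails since y < y + n + 1.
  probe-zero : ∀ e n → ∃[ d ] probe e n d ≡ 0
  probe-zero e n with em {HaltsAbove e n 0}
  probe-zero e n | yes (r , refl , y , r⇓ , _) with χ-halting (query ⌜ r ⌝ n (suc (y + n)))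
  ... | inj₂ (_ , eq) = y , eq
  ... | inj₁ (∈∅′ , _) with r′ , r′≡ , y′ , r′⇓ , y<y′ ← query⇒HaltsAbove ⌜ r ⌝ n (suc (y + n)) ∈∅′
    with refl ← ⌜⌝-injective r′ r r′≡
    with refl ← ⇓-deterministic r⇓ r′⇓ =
    ⊥-elim (<-irrefl refl (≤-trans (s≤s (m≤m+n y n)) y<y′))
  probe-zero e n | no ¬halts with χ-halting (query e n (suc n))
  ... | inj₂ (_ , eq) = 0 , eq
  ... | inj₁ (∈∅′ , _) with r , r≡ , y , r⇓ , _ ← query⇒HaltsAbove e n (suc n) ∈∅′ =
    ⊥-elim (¬halts (r , r≡ , y , r⇓ , z≤n))

  firstZero : ∀ e n → ∃[ d ] IsLeastZero (probe e n) d
  firstZero e n = let d , eq = probe-zero e n in leastZero (probe e n) d eq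

  -- Stage e is the interval from n = `stage e` to d + n inclusive, where d is the first zero of the
  -- probe; it is never empty.
  stage : ℕ → ℕ
  stage zero    = 0
  stage (suc e) = suc (proj₁ (firstZero e (stage e)) + stage e)

  stage-partition : IsPartition stage
  stage-partition = refl , λ e → s≤s (m≤n+m (stage e) _)

  -- The characteristic function of the set of the last elements of the stages.
  generic : ℕ → ℕ
  generic x = 1 ∸ (stage (suc (index stage x)) ∸ suc x)

  χ-generic : ∀ x → χ (generic x ≡ 1) (generic x)
  χ-generic x = χ-1∸ (stage (suc (index stage x)) ∸ suc x)
    where
    χ-1∸ : ∀ y → χ (1 ∸ y ≡ 1) (1 ∸ y)
    χ-1∸ zero    = inj₁ (refl , refl)
    χ-1∸ (suc y) rewrite 0∸n≡0 y = inj₂ ((λ ()) , refl)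

  -- The stage numbered by the code of a program for R starts at some n and ends exactly at `R n`,
  -- its only coloured element.
  generic-meets : (R : ℕ → ℕ) → Rec₁ ∅ R → (∀ n → n ≤ R n) →
                  ∃[ n ] (generic (R n) ≡ 1 × (∀ x → n ≤ x → x < R n → generic x ≡ 0))
  generic-meets R (rec r r⇓) n≤R = n , at-R , below-R
    where
    e = ⌜ r ⌝
    n = stage e
    d = proj₁ (firstZero e n)

    probe≡0 : ∀ d → probe e n d ≡ 0 → R n ≤ d + n
    probe≡0 d eq with χ-halting (query e n (suc (d + n))) | R n ≤? d + n
    ... | _               | yes R≤ = R≤
    ... | inj₁ (_ , eq′)  | no  R≰ with () ← trans (sym eq) eq′
    ... | inj₂ (∉∅′ , _)  | no  R≰ =
      ⊥-elim (∉∅′ (HaltsAbove⇒query e n (suc (d + n)) (r , refl , R n , r⇓ n , ≰⇒> R≰)))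

    probe≡1 : ∀ d {w} → probe e n d ≡ suc w → d + n < R n
    probe≡1 d eq with χ-halting (query e n (suc (d + n)))
    ... | inj₂ (_ , eq′) with () ← trans (sym eq) eq′
    ... | inj₁ (∈∅′ , _) with r′ , r′≡ , y′ , r′⇓ , d<y′ ← query⇒HaltsAbove e n (suc (d + n)) ∈∅′
      with refl ← ⌜⌝-injective r′ r r′≡
      with refl ← ⇓-deterministic (r⇓ n) r′⇓ = d<y′

    R≤d+n : R n ≤ d + n
    R≤d+n = probe≡0 d (proj₁ (proj₂ (firstZero e n)))

    d+n≤R : d + n ≤ R n
    d+n≤R with d + n ≤? R n
    ... | yes d+n≤R = d+n≤R
    -- Otherwise `R n ∸ n` lies before the first zero, so its query succeeds and gives R n < R n.
    ... | no  d+n≰R = ⊥-elim (<-irrefl (m∸n+n≡m (n≤R n)) (probe≡1 (R n ∸ n) (proj₂ below)))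
      where
      below = proj₂ (proj₂ (firstZero e n)) (R n ∸ n)
                (+-cancelʳ-< n _ d (subst (_< d + n) (sym (m∸n+n≡m (n≤R n))) (≰⇒> d+n≰R)))

    stage≡ : stage (suc e) ≡ suc (R n)
    stage≡ = cong suc (≤-antisym d+n≤R R≤d+n)

    value : ∀ x → n ≤ x → x < suc (R n) → generic x ≡ 1 ∸ (R n ∸ x)
    value x n≤x x<R =
      trans (cong (λ k → 1 ∸ (stage (suc k) ∸ suc x))
                  (InBlock⇒index stage-partition (n≤x , subst (x <_) (sym stage≡) x<R)))
            (cong (λ m → 1 ∸ (m ∸ suc x)) stage≡)

    at-R : generic (R n) ≡ 1
    at-R = trans (value (R n) (n≤R n) ≤-refl) (cong (1 ∸_) (n∸n≡0 (R n)))

    below-R : ∀ x → n ≤ x → x < R n → generic x ≡ 0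
    below-R x n≤x x<R = trans (value x n≤x (m<n⇒m<1+n x<R)) (m≤n⇒m∸n≡0 (m<n⇒0<n∸m x<R))

  generic-rec : Rec₁ ∅′ generic
  generic-rec =
    fun₁ (app₂ ∸-rec (lit 1)
           (app₂ ∸-rec (app₁ stage-rec (app₁ suc-rec (app₁ index-stage (var zero))))
                       (app₁ suc-rec (var zero))))
    where
    halting-rec : Rec₁ ∅′ halting
    halting-rec = rec oracle (λ c → ⇓oracle (χ-halting c))

    firstZero-rec : Rec₂ ∅′ (λ e n → proj₁ (firstZero e n))
    firstZero-rec =
      mu₂ (app₁ halting-rec
            (app₃ query-rec (var (suc zero)) (var (suc (suc zero)))
              (app₁ suc-rec (app₂ +-rec (var zero) (var (suc (suc zero)))))))
          (λ e n → proj₂ (firstZero e n))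

    stage-rec : Rec₁ ∅′ stage
    stage-rec =
      prec₁ (app₁ suc-rec (app₂ +-rec (app₂ firstZero-rec (var zero) (var (suc zero))) (var (suc zero))))
            (λ _ → refl)

    index-stage : Rec₁ ∅′ (index stage)
    index-stage = section (index-rec {start = λ _ → stage} (fun₂ (app₁ stage-rec (var (suc zero))))) 0

  generic-IsGeneric : IsGeneric generic
  generic-IsGeneric = generic-rec , χ-generic , generic-meets

generic-exists : ExcludedMiddle 0ℓ → ∃[ g ] IsGeneric g
generic-exists em =
  _ , Generic.generic-IsGeneric em queryCode queryCode-rec HaltsAbove⇒∅′ ∅′⇒HaltsAbove

-- Blocks of prescribed sizes

starts : (ℕ → ℕ) → ℕ → ℕ
starts N zero    = 0
starts N (suc k) = starts N k + N k

block : (ℕ → ℕ) → ℕ → ℕ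
block N = index (starts N)

offset : (ℕ → ℕ) → ℕ → ℕ
offset N x = x ∸ starts N (block N x)

-- Keeps block number and offset while the block sizes change from N to M. It gives the one-one
-- reductions when N ≤ M, and the reduction of `A` to `C i` when N is the factorial.
transfer : (ℕ → ℕ) → (ℕ → ℕ) → ℕ → ℕ
transfer N M x = starts M (block N x) + offset N x

-- Wraps [m , 2m) onto [0 , m) and fixes [0 , m).
fold : ℕ → ℕ → ℕ
fold m r = r ∸ m * (1 ∸ (m ∸ r))

-- The blocks of `_!` are the intervals I_k; with N the sizes for C_i, this is h_i.
collapse : (ℕ → ℕ) → ℕ → ℕ
collapse N x = starts _! (block N x) + fold (block N x !) (offset N x)

fold-< : ∀ {m r} → r < m → fold m r ≡ r
fold-< {m} {r} r<m rewrite m≤n⇒m∸n≡0 (m<n⇒0<n∸m r<m) | *-zeroʳ m = refl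

fold-≥ : ∀ {m r} → m ≤ r → fold m r ≡ r ∸ m
fold-≥ {m} {r} m≤r rewrite m≤n⇒m∸n≡0 m≤r | *-identityʳ m = refl

fold-bounded : ∀ {m r} → r < 2 * m → fold m r < m
fold-bounded {m} {r} r<2m with m ≤? r
... | no  m≰r = subst (_< m) (sym (fold-< (≰⇒> m≰r))) (≰⇒> m≰r)
... | yes m≤r = subst (_< m) (sym (fold-≥ m≤r))
                  (subst (r ∸ m <_) (trans (m+n∸m≡n m (m + 0)) (+-identityʳ m)) (∸-monoˡ-< r<2m m≤r))

fold-fibre : ∀ m r → r ≡ fold m r ⊎ r ≡ fold m r + m
fold-fibre m r with m ≤? r
... | no  m≰r = inj₁ (sym (fold-< (≰⇒> m≰r)))
... | yes m≤r = inj₂ (trans (sym (m∸n+n≡m m≤r)) (cong (_+ m) (sym (fold-≥ m≤r))))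

module _ {N : ℕ → ℕ} (N>0 : ∀ k → 0 < N k) where

  starts-partition : IsPartition (starts N)
  starts-partition = refl , λ k → m<m+n (starts N k) (N>0 k)

  starts+offset : ∀ x → starts N (block N x) + offset N x ≡ x
  starts+offset x = m+[n∸m]≡n (proj₁ (index-InBlock starts-partition x))

  offset-< : ∀ x → offset N x < N (block N x)
  offset-< x = +-cancelˡ-< (starts N (block N x)) _ _
    (subst (_< starts N (suc (block N x))) (sym (starts+offset x))
           (proj₂ (index-InBlock starts-partition x)))

  block-at : ∀ {k r} → r < N k → block N (starts N k + r) ≡ k
  block-at {k} {r} r<N =
    InBlock⇒index starts-partition (m≤m+n _ r , +-monoʳ-< (starts N k) r<N)

  offset-at : ∀ {k r} → r < N k → offset N (starts N k + r) ≡ r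
  offset-at {k} {r} r<N rewrite block-at r<N = m+n∸m≡n (starts N k) r

module _ {N M : ℕ → ℕ} (N>0 : ∀ k → 0 < N k) (N≤M : ∀ k → N k ≤ M k) where

  private
    M>0 : ∀ k → 0 < M k
    M>0 k = <-≤-trans (N>0 k) (N≤M k)

    offset-<M : ∀ x → offset N x < M (block N x)
    offset-<M x = <-≤-trans (offset-< N>0 x) (N≤M _)

  block-transfer : ∀ x → block M (transfer N M x) ≡ block N x
  block-transfer x = block-at M>0 (offset-<M x)

  offset-transfer : ∀ x → offset M (transfer N M x) ≡ offset N x
  offset-transfer x = offset-at M>0 (offset-<M x)

  transfer-injective : Injective _≡_ _≡_ (transfer N M)
  transfer-injective {x} {y} eq =
    trans (sym (starts+offset N>0 x))
      (trans (cong₂ (λ k r → starts N k + r)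
                    (trans (sym (block-transfer x)) (trans (cong (block M) eq) (block-transfer y)))
                    (trans (sym (offset-transfer x)) (trans (cong (offset M) eq) (offset-transfer y))))
             (starts+offset N>0 y))

!>0 : ∀ k → 0 < k !
!>0 = 1≤n!

module _ {N : ℕ → ℕ} (!≤N : ∀ k → k ! ≤ N k) (N≤2! : ∀ k → N k ≤ 2 * k !) where

  private
    N>0 : ∀ k → 0 < N k
    N>0 k = <-≤-trans (!>0 k) (!≤N k)

    fold-offset-< : ∀ x → fold (block N x !) (offset N x) < block N x !
    fold-offset-< x = fold-bounded (<-≤-trans (offset-< N>0 x) (N≤2! _))

  block-collapse : ∀ x → block _! (collapse N x) ≡ block N x
  block-collapse x = block-at !>0 (fold-offset-< x)

  -- Offsets below k! are not folded. The section obtained shows that `h i` is onto and also reduces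
  -- `A` to `C i`.
  collapse-transfer : ∀ y → collapse N (transfer _! N y) ≡ y
  collapse-transfer y =
    trans (cong₂ (λ k r → starts _! k + fold (k !) r)
                 (block-transfer !>0 !≤N y) (offset-transfer !>0 !≤N y))
      (trans (cong (starts _! (block _! y) +_) (fold-< (offset-< !>0 y)))
             (starts+offset !>0 y))

  offset-collapse : ∀ x → offset _! (collapse N x) ≡ fold (block N x !) (offset N x)
  offset-collapse x = offset-at !>0 {block N x} (fold-offset-< x)

  collapse-fibres : FibresBoundedBy 2 (collapse N)
  collapse-fibres y = fibre (block _! y) (offset _! y) , ≤-refl , covers
    where
    fibre : ℕ → ℕ → List ℕ
    fibre k r = starts N k + r ∷ᴸ starts N k + (r + k !) ∷ᴸ []ᴸ

    covers : ∀ x → collapse N x ≡ y → x ∈ fibre (block _! y) (offset _! y)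
    covers x refl =
      subst₂ (λ k r → x ∈ fibre k r) (sym (block-collapse x)) (sym (offset-collapse x))
        (case fold-fibre (block N x !) (offset N x) of λ where
          (inj₁ eq) → here (x≡ eq)
          (inj₂ eq) → there (here (x≡ eq)))
      where
      x≡ : ∀ {r} → offset N x ≡ r → x ≡ starts N (block N x) + r
      x≡ eq = trans (sym (starts+offset N>0 x)) (cong (starts N (block N x) +_) eq)

-- Computability of the block maps

module _ {O : Pred ℕ 0ℓ} where

  starts-rec : ∀ {N} → Rec₂ O N → Rec₂ O (λ i → starts (N i))
  starts-rec N-rec =
    prec₂ (lit 0) (app₂ +-rec (var (suc zero)) (app₂ N-rec (var (suc (suc zero))) (var zero)))
          (λ _ → refl) (λ _ _ → refl)

  block-rec : ∀ {N} → Rec₂ O N → Rec₂ O (λ i → block (N i))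
  block-rec {N} N-rec = index-rec {start = λ i → starts (N i)} (starts-rec N-rec)

  offset-rec : ∀ {N} → Rec₂ O N → Rec₂ O (λ i → offset (N i))
  offset-rec N-rec =
    fun₂ (app₂ ∸-rec (var (suc zero))
           (app₂ (starts-rec N-rec) (var zero) (app₂ (block-rec N-rec) (var zero) (var (suc zero)))))

  constantly : ∀ {F} → Rec₁ O F → Rec₂ O (λ _ → F)
  constantly F-rec = fun₂ (app₁ F-rec (var (suc zero)))

  block-rec₁ : ∀ {N} → Rec₁ O N → Rec₁ O (block N)
  block-rec₁ N-rec = section (block-rec (constantly N-rec)) 0

  starts-rec₁ : ∀ {N} → Rec₁ O N → Rec₁ O (starts N)
  starts-rec₁ N-rec = section (starts-rec (constantly N-rec)) 0

  offset-rec₁ : ∀ {N} → Rec₁ O N → Rec₁ O (offset N)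
  offset-rec₁ N-rec = section (offset-rec (constantly N-rec)) 0

  transfer-rec : ∀ {N M} → Rec₁ O N → Rec₁ O M → Rec₁ O (transfer N M)
  transfer-rec N-rec M-rec =
    fun₁ (app₂ +-rec (app₁ (starts-rec₁ M-rec) (app₁ (block-rec₁ N-rec) (var zero)))
                     (app₁ (offset-rec₁ N-rec) (var zero)))

  fold-rec : Rec₂ O fold
  fold-rec =
    fun₂ (app₂ ∸-rec (var (suc zero))
           (app₂ *-rec (var zero) (app₂ ∸-rec (lit 1) (app₂ ∸-rec (var zero) (var (suc zero))))))

  collapse-rec : ∀ {N} → Rec₂ O N → Rec₂ O (λ i → collapse (N i))
  collapse-rec {N} N-rec =
    fun₂ (app₂ +-rec (app₁ (starts-rec₁ !-rec) block-of)
                     (app₂ fold-rec (app₁ !-rec block-of)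
                                    (app₂ (offset-rec N-rec) (var zero) (var (suc zero)))))
    where
    block-of : Rec O {2} (λ xs → block (N (lookup xs zero)) (lookup xs (suc zero)))
    block-of = app₂ (block-rec N-rec) (var zero) (var (suc zero))

Rec₁⇒Computable : ∀ {F} → Rec₁ ∅ F → Computable F
Rec₁⇒Computable (rec p p⇓) = p , p⇓

-- Escape of an injection from the low blocks

injection-escapes : ∀ {f : ℕ → ℕ} → Injective _≡_ _≡_ f → ∀ a {m n} → m < n →
                    ∃[ r ] (r < n × m ≤ f (a + r))
injection-escapes {f} f-inj a {m} {n} m<n =
  let i , ¬f<m = ¬∀⟶∃¬ n (λ i → f (a + toℕ i) < m) (λ i → f (a + toℕ i) <? m) not-all
  in toℕ i , toℕ<n i , ≮⇒≥ ¬f<m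
  where
  not-all : ¬ (∀ i → f (a + toℕ i) < m)
  not-all f<m with i , j , i<j , eq ← pigeonhole m<n (λ i → fromℕ< (f<m i)) =
    <⇒≢ i<j (+-cancelˡ-≡ a _ _ (f-inj (trans (sym (toℕ-fromℕ< (f<m i)))
                                         (trans (cong toℕ eq) (toℕ-fromℕ< (f<m j))))))

-- In the terms of the overview, k is `large n`, and both l and R(n) are `target n`.
module Diagonal
  {f N M : ℕ → ℕ}
  (f-rec : Rec₁ ∅ f) (f-inj : Injective _≡_ _≡_ f)
  (N-rec : Rec₁ ∅ N) (N>0 : ∀ k → 0 < N k)
  (M-rec : Rec₁ ∅ M) (M>0 : ∀ k → 0 < M k)
  (N≫M : ∀ n → ∃[ k ] (n ≤ k × starts M (suc k) < N k))
  where

  private abstract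
    -- The search is for the distance d from n, so that k = d + n is at least n by construction.
    largeGap : ∀ n → ∃[ d ] IsLeastZero (λ d → suc (starts M (suc (d + n))) ∸ N (d + n)) d
    largeGap n with k , n≤k , M<N ← N≫M n =
      leastZero _ (k ∸ n) (subst (λ k → suc (starts M (suc k)) ∸ N k ≡ 0) (sym (m∸n+n≡m n≤k))
                                 (m≤n⇒m∸n≡0 M<N))

  large : ℕ → ℕ
  large n = proj₁ (largeGap n) + n

  M<N-large : ∀ n → starts M (suc (large n)) < N (large n)
  M<N-large n = m∸n≡0⇒m≤n (proj₁ (proj₂ (largeGap n)))

  private
    escape : ∀ n → ∃[ r ] (r < N (large n) × starts M (suc (large n)) ≤ f (starts N (large n) + r))
    escape n = injection-escapes f-inj (starts N (large n)) (M<N-large n)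

    abstract
      firstEscape : ∀ n → ∃[ r ] IsLeastZero (λ r → starts M (suc (large n)) ∸ f (starts N (large n) + r)) r
      firstEscape n = let r , _ , M≤f = escape n in leastZero _ r (m≤n⇒m∸n≡0 M≤f)

  escapee : ℕ → ℕ
  escapee n = starts N (large n) + proj₁ (firstEscape n)

  target : ℕ → ℕ
  target n = block M (f (escapee n))

  -- The search for an offset has no bound of its own. It stays inside the block because the
  -- pigeonhole principle supplies an escaping offset there, and the least one is no larger.
  block-escapee : ∀ n → block N (escapee n) ≡ large n
  block-escapee n = block-at N>0 (≤-<-trans first≤r (proj₁ (proj₂ (escape n))))
    where
    first≤r : proj₁ (firstEscape n) ≤ proj₁ (escape n)
    first≤r = ≮⇒≥ λ r<first →
      0≢1+n (trans (sym (m≤n⇒m∸n≡0 (proj₂ (proj₂ (escape n)))))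
                   (proj₂ (proj₂ (proj₂ (firstEscape n)) _ r<first)))

  large<target : ∀ n → large n < target n
  large<target n =
    ≤-pred (start-cancel-< (starts-partition M>0)
              (m∸n≡0⇒m≤n {n = f (escapee n)} (proj₁ (proj₂ (firstEscape n))))
              (proj₂ (index-InBlock (starts-partition M>0) (f (escapee n)))))

  n≤large : ∀ n → n ≤ large n
  n≤large n = m≤n+m n _

  target-rec : Rec₁ ∅ target
  target-rec = fun₁ (app₁ (block-rec₁ M-rec) (app₁ f-rec (app₁ escapee-rec (var zero))))
    where
    largeGap-rec : Rec₁ ∅ (λ n → proj₁ (largeGap n))
    largeGap-rec =
      mu₁ (app₂ ∸-rec
             (app₁ suc-rec (app₁ (starts-rec₁ M-rec) (app₁ suc-rec (app₂ +-rec (var zero) (var (suc zero))))))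
             (app₁ N-rec (app₂ +-rec (var zero) (var (suc zero)))))
          (λ n → proj₂ (largeGap n))

    large-rec : Rec₁ ∅ large
    large-rec = fun₁ (app₂ +-rec (app₁ largeGap-rec (var zero)) (var zero))

    firstEscape-rec : Rec₁ ∅ (λ n → proj₁ (firstEscape n))
    firstEscape-rec =
      mu₁ (app₂ ∸-rec
             (app₁ (starts-rec₁ M-rec) (app₁ suc-rec (app₁ large-rec (var (suc zero)))))
             (app₁ f-rec (app₂ +-rec (app₁ (starts-rec₁ N-rec) (app₁ large-rec (var (suc zero)))) (var zero))))
          (λ n → proj₂ (firstEscape n))

    escapee-rec : Rec₁ ∅ escapee
    escapee-rec = fun₁ (app₂ +-rec (app₁ (starts-rec₁ N-rec) (app₁ large-rec (var zero)))
                                   (app₁ firstEscape-rec (var zero)))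

-- Block sizes from rationals

num : ℚ → ℕ
num q = ∣ ↥ q ∣

positive-num : ∀ {q} → 0ℚ ℚ.< q → ↥ q ≡ ℤ.+ num q × 0 < num q
positive-num {q} q>0 = helper q (ℚ.positive q>0)
  where
  helper : ∀ q → ℚ.Positive q → ↥ q ≡ ℤ.+ num q × 0 < num q
  helper (ℚ.mkℚ +[1+ _ ] _ _) _                = refl , s≤s z≤n
  helper (ℚ.mkℚ +0       _ _) record { pos = () }
  helper (ℚ.mkℚ -[1+ _ ] _ _) record { pos = () }

cross-≤ : ∀ {p q} → ↥ p ≡ ℤ.+ num p → ↥ q ≡ ℤ.+ num q → p ℚ.≤ q → num p * ↧ₙ q ≤ num q * ↧ₙ p
cross-≤ {p} {q} p≡ q≡ p≤q = drop‿+≤+ (subst₂ ℤ._≤_ (lift p q p≡) (lift q p q≡) (ℚ.drop-*≤* p≤q))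
  where
  lift : ∀ p q → ↥ p ≡ ℤ.+ num p → ↥ p ℤ.* ↧ q ≡ ℤ.+ (num p * ↧ₙ q)
  lift p q p≡ = trans (cong (ℤ._* ↧ q) p≡) (sym (pos-* (num p) (↧ₙ q)))

-- A sum in ℚ is reduced to lowest terms, which hides its numerator. Among unnormalised rationals
-- the sum is the plain cross-multiplied fraction.
cross-+-≤ : ∀ {p q r} → ↥ p ≡ ℤ.+ num p → ↥ q ≡ ℤ.+ num q → ↥ r ≡ ℤ.+ num r → q ℚ.+ r ℚ.≤ p →
            (num q * ↧ₙ r + num r * ↧ₙ q) * ↧ₙ p ≤ num p * (↧ₙ q * ↧ₙ r)
cross-+-≤ {p@record{}} {q@record{}} {r@record{}} p≡ q≡ r≡ q+r≤p =
  drop‿+≤+ (subst₂ ℤ._≤_ left right (ℚᵘ.drop-*≤* q+ᵘr≤p))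
  where
  q+ᵘr≤p : ℚ.toℚᵘ q ℚᵘ.+ ℚ.toℚᵘ r ℚᵘ.≤ ℚ.toℚᵘ p
  q+ᵘr≤p = ℚᵘ.≤-respˡ-≃ (ℚ.toℚᵘ-homo-+ q r) (ℚ.toℚᵘ-mono-≤ q+r≤p)

  left : (↥ q ℤ.* ↧ r ℤ.+ ↥ r ℤ.* ↧ q) ℤ.* ↧ p ≡ ℤ.+ ((num q * ↧ₙ r + num r * ↧ₙ q) * ↧ₙ p)
  left = trans (cong (ℤ._* ↧ p)
                 (trans (cong₂ ℤ._+_ (trans (cong (ℤ._* ↧ r) q≡) (sym (pos-* (num q) (↧ₙ r))))
                                     (trans (cong (ℤ._* ↧ q) r≡) (sym (pos-* (num r) (↧ₙ q)))))
                        (sym (pos-+ (num q * ↧ₙ r) _))))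
               (sym (pos-* (num q * ↧ₙ r + num r * ↧ₙ q) (↧ₙ p)))

  right : ↥ p ℤ.* ℤ.+ (↧ₙ q * ↧ₙ r) ≡ ℤ.+ (num p * (↧ₙ q * ↧ₙ r))
  right = trans (cong (λ z → z ℤ.* ℤ.+ (↧ₙ q * ↧ₙ r)) p≡) (sym (pos-* (num p) (↧ₙ q * ↧ₙ r)))

-- ⌈ q w ⌉; the numerator is available only through codeℤ, hence the factor 2.
abstract
  leastSize : ∀ q w → ∃[ m ] IsLeastZero (λ m → codeℤ (↥ q) * w ∸ m * (2 * ↧ₙ q)) m
  leastSize q w =
    leastZero _ (codeℤ (↥ q) * w) (m≤n⇒m∸n≡0 (m≤m*n (codeℤ (↥ q) * w) (2 * ↧ₙ q)))

size : ℚ → ℕ → ℕ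
size q w = proj₁ (leastSize q w)

module _ {q : ℚ} (q≡ : ↥ q ≡ ℤ.+ num q) where

  private
    double : ∀ w → codeℤ (↥ q) * w ≡ 2 * (num q * w)
    double w = trans (cong (λ z → codeℤ z * w) q≡) (*-assoc 2 (num q) w)

    double′ : ∀ m → m * (2 * ↧ₙ q) ≡ 2 * (m * ↧ₙ q)
    double′ m = trans (sym (*-assoc m 2 (↧ₙ q))) (trans (cong (_* ↧ₙ q) (*-comm m 2)) (*-assoc 2 m (↧ₙ q)))

  size-≥ : ∀ w → num q * w ≤ size q w * ↧ₙ q
  size-≥ w = *-cancelˡ-≤ 2 (subst₂ _≤_ (double w) (double′ (size q w))
                              (m∸n≡0⇒m≤n (proj₁ (proj₂ (leastSize q w)))))

  size-least : ∀ w m → num q * w ≤ m * ↧ₙ q → size q w ≤ m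
  size-least w m qw≤m = ≮⇒≥ λ m<size →
    0≢1+n (trans (sym (m≤n⇒m∸n≡0 (subst₂ _≤_ (sym (double w)) (sym (double′ m)) (*-monoʳ-≤ 2 qw≤m))))
                 (proj₂ (proj₂ (proj₂ (leastSize q w)) m m<size)))

1≤⇒≤size : ∀ {q} → ↥ q ≡ ℤ.+ num q → 1ℚ ℚ.≤ q → ∀ w → w ≤ size q w
1≤⇒≤size {q} q≡ 1≤q w = *-cancelʳ-≤ w (size q w) (↧ₙ q) (begin
  w * ↧ₙ q          ≡⟨ *-comm w (↧ₙ q) ⟩
  ↧ₙ q * w          ≤⟨ *-monoˡ-≤ w (subst₂ _≤_ (*-identityˡ (↧ₙ q)) (*-identityʳ (num q)) (cross-≤ {1ℚ} {q} refl q≡ 1≤q)) ⟩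
  num q * w         ≤⟨ size-≥ q≡ w ⟩
  size q w * ↧ₙ q   ∎)
  where open ≤-Reasoning

≤2⇒size≤ : ∀ {q} → ↥ q ≡ ℤ.+ num q → q ℚ.≤ (ℤ.+ 2) ℚ./ 1 → ∀ w → size q w ≤ 2 * w
≤2⇒size≤ {q} q≡ q≤2 w = size-least q≡ w (2 * w) (begin
  num q * w         ≤⟨ *-monoˡ-≤ w (subst (_≤ 2 * ↧ₙ q) (*-identityʳ (num q)) (cross-≤ {q} {(ℤ.+ 2) ℚ./ 1} q≡ refl q≤2)) ⟩
  2 * ↧ₙ q * w      ≡⟨ *-assoc 2 (↧ₙ q) w ⟩
  2 * (↧ₙ q * w)    ≡⟨ cong (2 *_) (*-comm (↧ₙ q) w) ⟩
  2 * (w * ↧ₙ q)    ≡⟨ *-assoc 2 w (↧ₙ q) ⟨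
  2 * w * ↧ₙ q      ∎)
  where open ≤-Reasoning

size-mono : ∀ {p q} → ↥ p ≡ ℤ.+ num p → ↥ q ≡ ℤ.+ num q → p ℚ.≤ q → ∀ w → size p w ≤ size q w
size-mono {p} {q} p≡ q≡ p≤q w = size-least p≡ w (size q w) (*-cancelʳ-≤ _ _ (↧ₙ q) (begin
  num p * w * ↧ₙ q          ≡⟨ solve 3 (λ a w d → a :* w :* d := a :* d :* w) refl (num p) w (↧ₙ q) ⟩
  num p * ↧ₙ q * w          ≤⟨ *-monoˡ-≤ w (cross-≤ {p} {q} p≡ q≡ p≤q) ⟩
  num q * ↧ₙ p * w          ≡⟨ solve 3 (λ b d w → b :* d :* w := b :* w :* d) refl (num q) (↧ₙ p) w ⟩
  num q * w * ↧ₙ p          ≤⟨ *-monoˡ-≤ (↧ₙ p) (size-≥ q≡ w) ⟩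
  size q w * ↧ₙ q * ↧ₙ p    ≡⟨ solve 3 (λ s d e → s :* d :* e := s :* e :* d) refl (size q w) (↧ₙ q) (↧ₙ p) ⟩
  size q w * ↧ₙ p * ↧ₙ q    ∎))
  where
  open ≤-Reasoning
  open +-*-Solver

-- With a = num p, b = num q, c = num r, d = ↧ₙ p, e = ↧ₙ q, g = ↧ₙ r: the
-- hypotheses say a/d ≥ b/e + c/g, t < (b/e) w and (a/d) w ≤ suc t + l.
gap-impossible : ∀ a b c d e g w t l → 0 < d → 0 < g → 0 < c →
                 (b * g + c * e) * d ≤ a * (e * g) → t * e < b * w → a * w ≤ (suc t + l) * d →
                 ¬ (suc l * g ≤ w)
gap-impossible a b c d e g w t l 0<d 0<g 0<c gap t<b a≤t l≤w =
  <⇒≱ (*-mono-≤ 0<d 0<g) (+-cancelʳ-≤ (c * e * d * w) (d * g) 0 (+-cancelˡ-≤ (b * w * (d * g)) _ _ (begin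
    b * w * (d * g) + (d * g + c * e * d * w)
      ≡⟨ solve 6 (λ b w d g c e → b :* w :* (d :* g) :+ (d :* g :+ c :* e :* d :* w)
                  := w :* ((b :* g :+ c :* e) :* d) :+ d :* g) refl b w d g c e ⟩
    w * ((b * g + c * e) * d) + d * g
      ≤⟨ +-monoˡ-≤ (d * g) (*-monoʳ-≤ w gap) ⟩
    w * (a * (e * g)) + d * g
      ≡⟨ solve 5 (λ w a e g d → w :* (a :* (e :* g)) :+ d :* g := a :* w :* (e :* g) :+ d :* g) refl w a e g d ⟩
    a * w * (e * g) + d * g
      ≤⟨ +-monoˡ-≤ (d * g) (*-monoˡ-≤ (e * g) a≤t) ⟩
    (suc t + l) * d * (e * g) + d * g
      ≡⟨ solve 5 (λ t l d e g → (con 1 :+ t :+ l) :* d :* (e :* g) :+ d :* g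
                  := (con 1 :+ t :* e) :* (d :* g) :+ (con 1 :+ l) :* g :* (e :* d)) refl t l d e g ⟩
    suc (t * e) * (d * g) + suc l * g * (e * d)
      ≤⟨ +-mono-≤ (*-monoˡ-≤ (d * g) t<b) (*-monoˡ-≤ (e * d) l≤w) ⟩
    b * w * (d * g) + w * (e * d)
      ≤⟨ +-monoʳ-≤ (b * w * (d * g)) (m≤n*m (w * (e * d)) c) ⟩
    b * w * (d * g) + c * (w * (e * d))
      ≡⟨ cong (λ z → b * w * (d * g) + z)
           (solve 4 (λ c w e d → c :* (w :* (e :* d)) := c :* e :* d :* w) refl c w e d) ⟩
    b * w * (d * g) + c * e * d * w
      ∎)))
  where
  open ≤-Reasoning
  open +-*-Solver
  instance
    c≢0 : ℕ.NonZero c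
    c≢0 = ℕ.>-nonZero 0<c

-- Write `size q w` as t + 1. Leastness gives t < q w, and r ≥ 1 / ↧ₙ r gives l + 1 ≤ r w; so t + 1
-- + l < q w + r w ≤ p w.
size-gap : ∀ {p q r} → ↥ p ≡ ℤ.+ num p → ↥ q ≡ ℤ.+ num q → 0ℚ ℚ.< r → q ℚ.+ r ℚ.≤ p →
           ∀ w l → 0 < size q w → suc l * ↧ₙ r ≤ w → size q w + l < size p w
size-gap {p} {q} {r} p≡ q≡ r>0 q+r≤p w l 0<size l≤w = ≰⇒> λ p≤q+l → impossible (size q w) refl p≤q+l
  where
  pw≤ : ∀ {m} → size p w ≤ m → num p * w ≤ m * ↧ₙ p
  pw≤ p≤m = ≤-trans (size-≥ p≡ w) (*-monoˡ-≤ (↧ₙ p) p≤m)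

  impossible : ∀ s → size q w ≡ s → ¬ (size p w ≤ size q w + l)
  impossible zero    eq _  = n≮0 (subst (0 <_) eq 0<size)
  impossible (suc t) eq p≤ =
    gap-impossible (num p) (num q) (num r) (↧ₙ p) (↧ₙ q) (↧ₙ r) w t l
      (s≤s z≤n) (s≤s z≤n) (proj₂ (positive-num r>0))
      (cross-+-≤ {p} {q} {r} p≡ q≡ (proj₁ (positive-num r>0)) q+r≤p)
      (≰⇒> λ b≤t → 1+n≰n (subst (_≤ t) eq (size-least q≡ w t b≤t)))
      (pw≤ (subst (λ s → size p w ≤ s + l) eq p≤))
      l≤w

starts-≤ : ∀ {M} → (∀ k → M k ≤ 2 * k !) → ∀ k → starts M k ≤ 2 * starts _! k
starts-≤ M≤ zero    = z≤n
starts-≤ M≤ (suc k) =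
  ≤-trans (+-mono-≤ (starts-≤ M≤ k) (M≤ k)) (≤-reflexive (sym (*-distribˡ-+ 2 (starts _! k) (k !))))

-- The step rests on 2 (k + 1)! ≤ (k + 2)!. Its analogue 2 · 0! ≤ 1! fails, whence the second base
-- case.
starts-!-≤ : ∀ k → starts _! (suc k) ≤ 2 * k !
starts-!-≤ 0             = s≤s z≤n
starts-!-≤ 1             = ≤-refl
starts-!-≤ (suc (suc k)) = begin
  starts _! (2 + k) + (2 + k) !        ≤⟨ +-monoˡ-≤ ((2 + k) !) (starts-!-≤ (suc k)) ⟩
  2 * suc k ! + (2 + k) !              ≤⟨ +-monoˡ-≤ ((2 + k) !) (*-monoˡ-≤ (suc k !) (m≤m+n 2 k)) ⟩
  (2 + k) ! + (2 + k) !                ≡⟨ cong (λ z → (2 + k) ! + z) (+-identityʳ ((2 + k) !)) ⟨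
  2 * (2 + k) !                        ∎
  where open ≤-Reasoning

-- A gap r between the densities is worth r k! elements of block k, and all
-- earlier blocks together have only O((k ∸ 1)!) elements.
size-dominates : ∀ {p q r} {M : ℕ → ℕ} → ↥ p ≡ ℤ.+ num p → ↥ q ≡ ℤ.+ num q → 0ℚ ℚ.< r →
                 q ℚ.+ r ℚ.≤ p → (∀ k → M k ≤ 2 * k !) →
                 ∀ k → 0 < M k → M k ≡ size q (k !) → 5 * ↧ₙ r ≤ k → starts M (suc k) < size p (k !)
size-dominates {p} {q} {r} {M} p≡ q≡ r>0 gap M≤ (suc k) M>0 M≡ 5r≤k = begin-strict
  starts M (suc k) + M (suc k)                  ≡⟨ +-comm (starts M (suc k)) (M (suc k)) ⟩
  M (suc k) + starts M (suc k)                  ≤⟨ +-monoʳ-≤ (M (suc k)) (starts-≤ M≤ (suc k)) ⟩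
  M (suc k) + 2 * starts _! (suc k)             ≡⟨ cong (λ m → m + 2 * starts _! (suc k)) M≡ ⟩
  size q (suc k !) + 2 * starts _! (suc k)
    <⟨ size-gap {p} {q} {r} p≡ q≡ r>0 gap (suc k !) _ (subst (0 <_) M≡ M>0) small ⟩
  size p (suc k !)                              ∎
  where
  open ≤-Reasoning
  -- Origin of the 5: the leading 1 is at most k!, and 4 k! comes from block sizes of at most 2 l!
  -- together with the bound 2 k! on the sum of the factorials up to k!.
  small : suc (2 * starts _! (suc k)) * ↧ₙ r ≤ suc k !
  small = begin
    suc (2 * starts _! (suc k)) * ↧ₙ r
      ≤⟨ *-monoˡ-≤ (↧ₙ r) (+-mono-≤ (!>0 k) (*-monoʳ-≤ 2 (starts-!-≤ k))) ⟩
    (k ! + 2 * (2 * k !)) * ↧ₙ r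
      ≡⟨ solve 2 (λ f d → (f :+ con 2 :* (con 2 :* f)) :* d := con 5 :* d :* f) refl (k !) (↧ₙ r) ⟩
    5 * ↧ₙ r * k !
      ≤⟨ *-monoˡ-≤ (k !) 5r≤k ⟩
    suc k * k !  ∎
    where open +-*-Solver

-- The set A, the maps h_i and the clauses of the theorem

blockStart≡starts : ∀ k → blockStart k ≡ starts _! k
blockStart≡starts zero    = refl
blockStart≡starts (suc k) = cong (_+ k !) (blockStart≡starts k)

Block⇒block : ∀ {k x} → Block k x → block _! x ≡ k
Block⇒block {k} {x} (lo , hi) =
  InBlock⇒index (starts-partition !>0)
    (subst (_≤ x) (blockStart≡starts k) lo , subst (x <_) (blockStart≡starts (suc k)) hi)

module Construction
  (generic : ℕ → ℕ) (generic-IsGeneric : IsGeneric generic)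
  (N : ℕ → ℕ → ℕ) (N-rec : Rec₂ ∅ N)
  (!≤N : ∀ i k → k ! ≤ N i k) (N≤2! : ∀ i k → N i k ≤ 2 * k !)
  where

  private
    generic-rec : Rec₁ ∅′ generic
    generic-rec = proj₁ generic-IsGeneric

    N>0 : ∀ i k → 0 < N i k
    N>0 i k = <-≤-trans (!>0 k) (!≤N i k)

  A : Pred ℕ 0ℓ
  A x = generic (block _! x) ≡ 1

  h : ℕ → ℕ → ℕ
  h i = collapse (N i)

  C : ℕ → Pred ℕ 0ℓ
  C i x = A (h i x)

  generic-⇔ : ∀ {k l} → k ≡ l → (generic k ≡ 1) ⇔ (generic l ≡ 1)
  generic-⇔ refl = mk⇔ id id

  C-⇔ : ∀ i x → C i x ⇔ (generic (block (N i) x) ≡ 1)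
  C-⇔ i x = generic-⇔ (block-collapse (!≤N i) (N≤2! i) x)

  A-computable : A ComputableIn ∅′
  A-computable = Rec₁.prog A-rec , λ x → _ , proj₁ (proj₂ generic-IsGeneric) (block _! x) , Rec₁.runs A-rec x
    where
    A-rec : Rec₁ ∅′ (λ x → generic (block _! x))
    A-rec = fun₁ (app₁ generic-rec (app₁ (block-rec₁ !-rec) (var zero)))

  h-computable : Computable₂ h
  h-computable = Rec₂.prog h-rec , λ i x _ → Rec₂.runs h-rec i x
    where
    h-rec : Rec₂ ∅ h
    h-rec = collapse-rec N-rec

  h-surjective : ∀ i → StrictlySurjective _≡_ (h i)
  h-surjective i y = transfer _! (N i) y , collapse-transfer (!≤N i) (N≤2! i) y

  A-constant : ∀ k → ConstantOn (Block k) A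
  A-constant k x y x∈ y∈ = generic-⇔ (trans (Block⇒block {k} x∈) (sym (Block⇒block {k} y∈)))

  h-fibres : ∀ i → FibresBoundedBy 2 (h i)
  h-fibres i = collapse-fibres (!≤N i) (N≤2! i)

  C≡bfoA : ∀ i → C i ≡bfo A
  C≡bfoA i =
    (h i , Rec₁⇒Computable (section (collapse-rec N-rec) i) , (2 , s≤s z≤n , h-fibres i) , λ _ → mk⇔ id id) ,
    (transfer _! (N i) , Rec₁⇒Computable (transfer-rec !-rec (section N-rec i)) ,
     -- Since `h i` is a left inverse of `transfer`, only `h i z` can be sent to z.
     (1 , ≤-refl , λ z → h i z ∷ᴸ []ᴸ , ≤-refl ,
        λ { y refl → here (sym (proj₂ (h-surjective i y))) }) ,
     λ y → generic-⇔ (cong (block _!) (sym (proj₂ (h-surjective i y)))))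

  C-≤₁ : ∀ i j → (∀ k → N i k ≤ N j k) → C i ≤₁ C j
  C-≤₁ i j Nᵢ≤Nⱼ =
    transfer (N i) (N j) , Rec₁⇒Computable (transfer-rec (section N-rec i) (section N-rec j)) ,
    transfer-injective (N>0 i) Nᵢ≤Nⱼ ,
    λ x → ⇔-sym (C-⇔ j (transfer (N i) (N j) x)) ⇔-∘
          (generic-⇔ (sym (block-transfer (N>0 i) Nᵢ≤Nⱼ x)) ⇔-∘ C-⇔ i x)

  C-≰₁ : ∀ i j → (∀ n → ∃[ k ] (n ≤ k × starts (N j) (suc k) < N i k)) → ¬ (C i ≤₁ C j)
  C-≰₁ i j N≫ (f , (p , p⇓) , f-inj , f-reduces) =
    0≢1+n (trans (sym (below (large n) (n≤large n) (large<target n)))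
                 (subst (λ k → generic k ≡ 1) (block-escapee n) Cᵢ-escapee))
    where
    open Diagonal {f} {N i} {N j} (rec p p⇓) f-inj (section N-rec i) (N>0 i) (section N-rec j) (N>0 j) N≫

    meeting : ∃[ n ] (generic (target n) ≡ 1 × (∀ x → n ≤ x → x < target n → generic x ≡ 0))
    meeting = proj₂ (proj₂ generic-IsGeneric) target target-rec (λ n → ≤-trans (n≤large n) (<⇒≤ (large<target n)))

    n : ℕ
    n = proj₁ meeting

    below : ∀ x → n ≤ x → x < target n → generic x ≡ 0
    below = proj₂ (proj₂ meeting)

    Cᵢ-escapee : generic (block (N i) (escapee n)) ≡ 1
    Cᵢ-escapee = Equivalence.to (C-⇔ i (escapee n)) (Equivalence.from (f-reduces (escapee n))
                   (Equivalence.from (C-⇔ j (f (escapee n))) (proj₁ (proj₂ meeting))))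

profile-num : ∀ {u} → IsBlockDensityProfile u → ∀ k → ↥ u k ≡ ℤ.+ num (u k)
profile-num u-profile k = proj₁ (positive-num (ℚ.<-trans (ℚ.positive⁻¹ 1ℚ) (proj₁ (u-profile k))))

theorem3p2 : ExcludedMiddle 0ℓ →
    (u : ℕ → ℕ → ℚ) →
    (∀ i → IsBlockDensityProfile (u i)) →
    Computable₂ℚ u →
    (D : Rel ℕ 0ℓ) →
    ComputableRel D →
    (δ : ℕ → ℕ → ℚ) →
    Computable₂ℚOn D δ →
    (∀ i j → D i j → 0ℚ ℚ.< δ i j) →
    (s : ℕ → ℕ → ℕ → ℕ) →
    Computable₃On D s →
    (∀ i j → D i j → s i j Preserves ℕ._<_ ⟶ ℕ._<_) →
    (∀ i j → D i j → Infinite (Range (s i j))) →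
    (∀ i j → D i j → ∀ k → Range (s i j) k → u i k ℚ.≥ u j k ℚ.+ δ i j) →
    ∃[ A ] ∃[ h ]
    let C = λ (i x : ℕ) → A (h i x) in
    (A ComputableIn ∅′)
    × Computable₂ h
    × (∀ i → StrictlySurjective _≡_ (h i))
    × (∀ k → ConstantOn (Block k) A)
    × (∀ i → FibresBoundedBy 2 (h i))
    × (∀ i → C i ≡bfo A)
    × (∀ i j → (∀ k → u i k ℚ.≤ u j k) → C i ≤₁ C j)
    × (∀ i j → D i j → ¬ (C i ≤₁ C j))
    × (∀ i j → (∀ k → u i k ℚ.≤ u j k) → D j i → C i <₁ C j)
theorem3p2 em u u-profile ((code , code⇓) , (den , den⇓)) D _ δ _ δ>0 s _ _ s-infinite s-gap =
  A , h , A-computable , h-computable , h-surjective , A-constant , h-fibres , C≡bfoA ,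
  reduces , separates , λ i j u≤ Dji → reduces i j u≤ , separates j i Dji
  where
  u≡ : ∀ i k → ↥ u i k ≡ ℤ.+ num (u i k)
  u≡ i = profile-num (u-profile i)

  N : ℕ → ℕ → ℕ
  N i k = size (u i k) (k !)

  N-rec : Rec₂ ∅ N
  N-rec =
    mu₂ (app₂ ∸-rec (app₂ *-rec (app₂ code-rec (var (suc zero)) (var (suc (suc zero))))
                                (app₁ !-rec (var (suc (suc zero)))))
                    (app₂ *-rec (var zero)
                      (app₂ *-rec (lit 2) (app₂ den-rec (var (suc zero)) (var (suc (suc zero)))))))
        (λ i k → proj₂ (leastSize (u i k) (k !)))
    where
    code-rec : Rec₂ ∅ (λ i k → codeℤ (↥ u i k))
    code-rec = rec code (λ i k → code⇓ i k tt)

    den-rec : Rec₂ ∅ (λ i k → ↧ₙ u i k)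
    den-rec = rec den (λ i k → den⇓ i k tt)

  !≤N : ∀ i k → k ! ≤ N i k
  !≤N i k = 1≤⇒≤size (u≡ i k) (ℚ.<⇒≤ (proj₁ (u-profile i k))) (k !)

  N≤2! : ∀ i k → N i k ≤ 2 * k !
  N≤2! i k = ≤2⇒size≤ (u≡ i k) (ℚ.<⇒≤ (proj₂ (u-profile i k))) (k !)

  open Construction (proj₁ (generic-exists em)) (proj₂ (generic-exists em)) N N-rec !≤N N≤2!

  reduces : ∀ i j → (∀ k → u i k ℚ.≤ u j k) → C i ≤₁ C j
  reduces i j u≤ = C-≤₁ i j (λ k → size-mono (u≡ i k) (u≡ j k) (u≤ k) (k !))

  separates : ∀ i j → D i j → ¬ (C i ≤₁ C j)
  separates i j Dij = C-≰₁ i j λ n →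
    -- One element of the range serves both demands: k ≥ n for the search, and k ≥ 5 times the
    -- denominator for domination.
    let k , n+≤k , k∈S = s-infinite i j Dij (n + 5 * ↧ₙ δ i j)
    in k , ≤-trans (m≤m+n n _) n+≤k ,
       size-dominates {M = N j} (u≡ i k) (u≡ j k) (δ>0 i j Dij) (s-gap i j Dij k k∈S) (N≤2! j) k
         (<-≤-trans (!>0 k) (!≤N j k)) refl (≤-trans (m≤n+m _ n) n+≤k)
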